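{- Let $p>3$ be a prime number. Then $$\sum_{k=1}^{p-1}\frac{1}{k\,2^k}\equiv H'_{p-1}\pmod p .$$
   Context: For an odd prime $p$, $H'_{p-1}:=1+\frac13+\frac15+\dots+\frac1{p-2}$ is the sum of the reciprocals of the odd integers between $1$ and $p-2$. Congruences modulo $p$ are between rational numbers whose denominators are prime to $p$ (i.e. congruences in the localization $\mathbb{Z}_{(p)}$). -}

module Defs where

import Algebra.Properties.CommutativeMonoid.Sum as CommutativeMonoidSum
open import Data.Bool.Base using (if_then_else_)
open import Data.Fin.Base using (toℕ)
open import Data.Integer.Base using (+_)
open import Data.Nat.Base as ℕ using (ℕ; suc; _∸_; _^_; NonZero)
open import Data.Nat.Coprimality using (Coprime)
open import Data.Nat.Divisibility using (_∣?_)
open import Data.Nat.Properties using (m*n≢0; m^n≢0)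
open import Data.Product.Base using (∃-syntax; _×_)
open import Data.Rational.Base using (ℚ; 0ℚ; _/_; _-_; _*_; ↧ₙ_)
open import Data.Rational.Properties using (+-0-commutativeMonoid)
open import Function.Base using (it)
open import Relation.Binary.PropositionalEquality.Core using (_≡_)
open import Relation.Nullary.Decidable.Core using (does)

open CommutativeMonoidSum +-0-commutativeMonoid public using (sum-syntax)

-- For p prime, membership in the localization ℤ₍ₚ₎ (↧ₙ_ is the denominator
-- in lowest terms).
Integral : ℕ → ℚ → Set
Integral p x = Coprime (↧ₙ x) p

infix 4 _≡_[mod_]

-- x and y lie in ℤ₍ₚ₎ and x - y ∈ pℤ₍ₚ₎.
_≡_[mod_] : ℚ → ℚ → ℕ → Set
x ≡ y [mod p ] =
  Integral p x × Integral p y ×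
  ∃[ z ] (Integral p z × x - y ≡ (+ p / 1) * z)

1/[_*2^_] : ∀ k n → .{{NonZero k}} → ℚ
1/[ k *2^ n ] = _/_ (+ 1) (k ℕ.* 2 ^ n) {{m*n≢0 k (2 ^ n) {{it}} {{m^n≢0 2 n}}}}

oddReciprocal : ∀ k → .{{NonZero k}} → ℚ
oddReciprocal k = if does (2 ∣? k) then 0ℚ else + 1 / k

-- The sum of 1 / k over the odd k with 1 ≤ k ≤ n ∸ 1, indexed by i = k - 1; the
-- range ends at n ∸ 1 so that H′ (p ∸ 1) runs over the odd k with 1 ≤ k ≤ p ∸ 2.
H′ : ℕ → ℚ
H′ n = ∑[ i < n ∸ 1 ] oddReciprocal (suc (toℕ i))

{-# OPTIONS --safe #-}

-- Write p = n + 1 and L(x) = ∑ xᵏ/k over 0 < k < p. The two sides are L(½) and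
-- ½ (L(1) - L(-1)). Since (-1)ᵏ⁻¹ C(p, k) / p = (-1)ᵏ⁻¹ C(n, k - 1) / k ≡ 1/k,
-- the binomial theorem gives L(x) ≡ (1 + (-x)ᵖ - (1 - x)ᵖ) / p, so the two sides
-- are congruent to T = (1 - 2⁻ⁿ) / p and U = (2ⁿ - 1) / p, and T - U = - p T U.

module Submission where

open import Defs
open import Algebra.Bundles using (CommutativeRing)
open import Data.Bool.Base using (if_then_else_)
open import Data.Empty using (⊥-elim)
open import Data.Fin.Base using (Fin; toℕ; zero; suc; inject₁; fromℕ)
open import Data.Fin.Properties using (toℕ-inject₁; toℕ-fromℕ; toℕ<n)
open import Data.Integer.Base as ℤ using (+_)
import Data.Integer.GCD as ℤ
import Data.Integer.Properties as ℤ
open import Data.Nat.Base as ℕ using (ℕ; zero; suc; _∸_; _<_; z≤n; s≤s; NonZero)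
open import Data.Nat.Combinatorics using (_C_; nC1≡n; nCn≡1; nCk+nC[k+1]≡[n+1]C[k+1])
import Data.Nat.Coprimality as Coprimality
open Coprimality using (Coprime; coprime-divisor; prime⇒coprime; 1-coprimeTo)
open import Data.Nat.Divisibility
  using (_∣_; _∣?_; divides; ∣-refl; ∣-trans; ∣m+n∣m⇒∣n; ∣m∣n⇒∣m+n; _∣0; >⇒∤)
open import Data.Nat.Primality using (Prime)
import Data.Nat.Properties as ℕ
open import Data.Nat.Tactic.RingSolver using (solve-∀)
open import Data.Product.Base using (_,_; proj₁; proj₂)
open import Data.Rational.Base
  using (ℚ; mkℚ; 0ℚ; 1ℚ; ½; _/_; ↥_; ↧_; ↧ₙ_; _+_; _*_; _-_; -_; toℚᵘ; fromℚᵘ)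
open import Data.Rational.Properties
open import Data.Rational.Solver using (module +-*-Solver)
import Data.Rational.Unnormalised.Base as ℚᵘ
import Data.Rational.Unnormalised.Properties as ℚᵘ
open import Function.Base using (_∘_; case_of_)
open import Relation.Binary.PropositionalEquality
  using (_≡_; refl; sym; trans; cong; cong₂; subst; module ≡-Reasoning)
open import Relation.Nullary using (¬_; Dec; yes; no; does)

open CommutativeRing +-*-commutativeRing using (commutativeSemiring; semiring)
open import Algebra.Properties.Semiring.Exp semiring using (_^_)
open import Algebra.Properties.CommutativeSemiring.Exp commutativeSemiring
  using (^-distrib-*)
open import Algebra.Properties.Semiring.Sum semiring
  using (sum; sum-init-last; sum-cong-≗; ∑-distrib-+; *-distribˡ-sum)
open import Algebra.Properties.Semiring.Mult semiring using (_×_)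
import Algebra.Properties.CommutativeSemiring.Binomial commutativeSemiring as Binomial

open ≡-Reasoning
open +-*-Solver using (solve; _:=_; _:+_; _:*_; _:-_; :-_; con)

-- Arithmetic of fractions and the embedding of ℕ into ℚ.

ι : ℕ → ℚ
ι n = + n / 1

1/suc : ℕ → ℚ
1/suc i = + 1 / suc i

/-≃ : ∀ a m b n .{{_ : NonZero m}} .{{_ : NonZero n}} →
      a ℤ.* + n ≡ b ℤ.* + m → a / m ≡ b / n
/-≃ a (suc m) b (suc n) eq = fromℚᵘ-cong {ℚᵘ.mkℚᵘ a m} {ℚᵘ.mkℚᵘ b n} (ℚᵘ.*≡* eq)

/-homo-* : ∀ a m b n .{{_ : NonZero m}} .{{_ : NonZero n}} .{{_ : NonZero (m ℕ.* n)}} →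
           (a / m) * (b / n) ≡ (a ℤ.* b) / (m ℕ.* n)
/-homo-* a (suc m) b (suc n) = toℚᵘ-injective
  (ℚᵘ.≃-trans (toℚᵘ-homo-* (a / suc m) (b / suc n))
  (ℚᵘ.≃-trans (ℚᵘ.*-cong (toℚᵘ-fromℚᵘ (ℚᵘ.mkℚᵘ a m)) (toℚᵘ-fromℚᵘ (ℚᵘ.mkℚᵘ b n)))
  (ℚᵘ.≃-sym (toℚᵘ-fromℚᵘ (ℚᵘ.mkℚᵘ a m ℚᵘ.* ℚᵘ.mkℚᵘ b n)))))

/-homo-+ : ∀ a b → (a / 1) + (b / 1) ≡ (a ℤ.+ b) / 1
/-homo-+ a b = toℚᵘ-injective
  (ℚᵘ.≃-trans (toℚᵘ-homo-+ (a / 1) (b / 1))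
  (ℚᵘ.≃-trans (ℚᵘ.+-cong (toℚᵘ-fromℚᵘ (ℚᵘ.mkℚᵘ a 0)) (toℚᵘ-fromℚᵘ (ℚᵘ.mkℚᵘ b 0)))
  (ℚᵘ.≃-trans (ℚᵘ.*≡* (cong (ℤ._* + 1) (cong₂ ℤ._+_ (ℤ.*-identityʳ a) (ℤ.*-identityʳ b))))
  (ℚᵘ.≃-sym (toℚᵘ-fromℚᵘ (ℚᵘ.mkℚᵘ (a ℤ.+ b) 0))))))

ι-homo-+ : ∀ m n → ι (m ℕ.+ n) ≡ ι m + ι n
ι-homo-+ m n = sym (/-homo-+ (+ m) (+ n))

ι-homo-* : ∀ m n → ι (m ℕ.* n) ≡ ι m * ι n
ι-homo-* m n = trans (cong (_/ 1) (ℤ.pos-* m n)) (sym (/-homo-* (+ m) 1 (+ n) 1))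

ι*1/suc : ∀ i → ι (suc i) * 1/suc i ≡ 1ℚ
ι*1/suc i = trans (/-homo-* (+ suc i) 1 (+ 1) (suc i))
  (/-≃ (+ suc i ℤ.* + 1) (1 ℕ.* suc i) (+ 1) 1 (cong +_ (rearrange i)))
  where
  rearrange : ∀ i → suc i ℕ.* 1 ℕ.* 1 ≡ 1 ℕ.* (1 ℕ.* suc i)
  rearrange = solve-∀

-- The library's binomial theorem writes its coefficients as repeated addition `_×_`; this turns
-- them into rational factors.
×≡ι* : ∀ m x → m × x ≡ ι m * x
×≡ι* zero    x = sym (*-zeroˡ x)
×≡ι* (suc m) x = begin
  x + m × x        ≡⟨ cong₂ _+_ (sym (*-identityˡ x)) (×≡ι* m x) ⟩
  1ℚ * x + ι m * x ≡⟨ *-distribʳ-+ x 1ℚ (ι m) ⟨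
  (1ℚ + ι m) * x   ≡⟨ cong (_* x) (ι-homo-+ 1 m) ⟨
  ι (suc m) * x    ∎

-- Powers of 1 and ½.

1^n≡1 : ∀ n → 1ℚ ^ n ≡ 1ℚ
1^n≡1 zero    = refl
1^n≡1 (suc n) = trans (*-identityˡ _) (1^n≡1 n)

½^n*2^n≡1 : ∀ n → ½ ^ n * ι 2 ^ n ≡ 1ℚ
½^n*2^n≡1 n = trans (sym (^-distrib-* ½ (ι 2) n)) (1^n≡1 n)

1/2^n : ∀ n .{{_ : NonZero (2 ℕ.^ n)}} → (+ 1 / 2 ℕ.^ n) ≡ ½ ^ n
1/2^n zero    = refl
1/2^n (suc n) = begin
  + 1 / (2 ℕ.* 2 ℕ.^ n) ≡⟨ /-homo-* (+ 1) 2 (+ 1) (2 ℕ.^ n) ⟨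
  ½ * (+ 1 / 2 ℕ.^ n)   ≡⟨ cong (½ *_) (1/2^n n) ⟩
  ½ * ½ ^ n             ∎
  where instance
    _ = ℕ.m^n≢0 2 n

1/[]-split : ∀ i n → 1/[ suc i *2^ n ] ≡ 1/suc i * ½ ^ n
1/[]-split i n = begin
  1/[ suc i *2^ n ]         ≡⟨ /-homo-* (+ 1) (suc i) (+ 1) (2 ℕ.^ n) ⟨
  1/suc i * (+ 1 / 2 ℕ.^ n) ≡⟨ cong (1/suc i *_) (1/2^n n) ⟩
  1/suc i * ½ ^ n           ∎
  where instance
    _ = ℕ.m^n≢0 2 n
    _ = ℕ.m*n≢0 (suc i) (2 ℕ.^ n)

-- Signs and parity.

sgn : ℕ → ℚ
sgn n = (- 1ℚ) ^ n

sgn-2+ : ∀ n → sgn (2 ℕ.+ n) ≡ sgn n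
sgn-2+ n = solve 1 (λ e → con (- 1ℚ) :* (con (- 1ℚ) :* e) := e) refl (sgn n)

sgn-even : ∀ n → 2 ∣ n → sgn n ≡ 1ℚ
sgn-even zero          _   = refl
sgn-even (suc zero)    2∣1 = ⊥-elim (>⇒∤ (s≤s (s≤s z≤n)) 2∣1)
sgn-even (suc (suc n)) 2∣n = trans (sgn-2+ n) (sgn-even n (∣m+n∣m⇒∣n 2∣n ∣-refl))

sgn-odd : ∀ n → ¬ 2 ∣ n → sgn n ≡ - 1ℚ
sgn-odd zero          2∤n = ⊥-elim (2∤n (2 ∣0))
sgn-odd (suc zero)    _   = refl
sgn-odd (suc (suc n)) 2∤n = trans (sgn-2+ n) (sgn-odd n (2∤n ∘ ∣m∣n⇒∣m+n ∣-refl))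

sgn*sgn≡1 : ∀ n → sgn n * sgn n ≡ 1ℚ
sgn*sgn≡1 n = trans (sym (^-distrib-* (- 1ℚ) (- 1ℚ) n)) (1^n≡1 n)

neg-^ : ∀ x n → (- x) ^ n ≡ sgn n * x ^ n
neg-^ x n = trans (cong (_^ n) (neg-mul x)) (^-distrib-* (- 1ℚ) x n)
  where
  neg-mul : ∀ x → - x ≡ - 1ℚ * x
  neg-mul = solve 1 (λ x → :- x := con (- 1ℚ) :* x) refl

-- The factor (1 - (-1)ᵏ) / 2 is the indicator function of the odd k.
oddReciprocal-sgn : ∀ i → oddReciprocal (suc i) ≡ ½ * ((1ℚ - sgn (suc i)) * 1/suc i)
-- The decision becomes a variable, so that matching on it reduces the conditional.
oddReciprocal-sgn i = by-parity (2 ∣? suc i)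
  where
  by-parity : (d : Dec (2 ∣ suc i)) →
              (if does d then 0ℚ else 1/suc i) ≡ ½ * ((1ℚ - sgn (suc i)) * 1/suc i)
  by-parity (yes 2∣k) rewrite sgn-even (suc i) 2∣k =
    solve 1 (λ r → con 0ℚ := con ½ :* ((con 1ℚ :- con 1ℚ) :* r)) refl (1/suc i)
  by-parity (no 2∤k) rewrite sgn-odd (suc i) 2∤k =
    solve 1 (λ r → r := con ½ :* ((con 1ℚ :- con (- 1ℚ)) :* r)) refl (1/suc i)

-- The absorption identity for binomial coefficients.

-- Induction on n: Pascal's rule splits the coefficient on the left, and after the induction
-- hypotheses it reassembles the one on the right.
[1+k]*[1+n]C[1+k]≡[1+n]*nCk : ∀ n k → suc k ℕ.* (suc n C suc k) ≡ suc n ℕ.* (n C k)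
[1+k]*[1+n]C[1+k]≡[1+n]*nCk n zero = begin
  1 ℕ.* (suc n C 1) ≡⟨ ℕ.*-identityˡ _ ⟩
  suc n C 1         ≡⟨ nC1≡n (suc n) ⟩
  suc n             ≡⟨ ℕ.*-identityʳ (suc n) ⟨
  suc n ℕ.* 1       ∎
[1+k]*[1+n]C[1+k]≡[1+n]*nCk zero    (suc k) = ℕ.*-zeroʳ k
[1+k]*[1+n]C[1+k]≡[1+n]*nCk (suc n) (suc k) = begin
  (2 ℕ.+ k) ℕ.* ((2 ℕ.+ n) C (2 ℕ.+ k))
    ≡⟨ cong ((2 ℕ.+ k) ℕ.*_) (nCk+nC[k+1]≡[n+1]C[k+1] (suc n) (suc k)) ⟨
  (2 ℕ.+ k) ℕ.* (a ℕ.+ b)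
    -- One copy of `a` is set aside; the two remaining products are the left sides of the induction
    -- hypotheses for k and k + 1.
    ≡⟨ regroup k a b ⟩
  a ℕ.+ (suc k ℕ.* a ℕ.+ (2 ℕ.+ k) ℕ.* b)
    ≡⟨ cong (a ℕ.+_) (cong₂ ℕ._+_ ([1+k]*[1+n]C[1+k]≡[1+n]*nCk n k)
                                  ([1+k]*[1+n]C[1+k]≡[1+n]*nCk n (suc k))) ⟩
  a ℕ.+ (suc n ℕ.* (n C k) ℕ.+ suc n ℕ.* (n C suc k))
    ≡⟨ cong (a ℕ.+_) (ℕ.*-distribˡ-+ (suc n) (n C k) (n C suc k)) ⟨
  a ℕ.+ suc n ℕ.* (n C k ℕ.+ n C suc k)
    ≡⟨ cong (λ c → a ℕ.+ suc n ℕ.* c) (nCk+nC[k+1]≡[n+1]C[k+1] n k) ⟩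
  (2 ℕ.+ n) ℕ.* a ∎
  where
  a = suc n C suc k
  b = suc n C (2 ℕ.+ k)
  regroup : ∀ k a b → (2 ℕ.+ k) ℕ.* (a ℕ.+ b) ≡ a ℕ.+ (suc k ℕ.* a ℕ.+ (2 ℕ.+ k) ℕ.* b)
  regroup = solve-∀

-- Dividing absorption by k + 1 displays C(p, k + 1), where p = n + 1, as p times an explicit
-- rational.
ι-absorption : ∀ n k → ι (suc n C suc k) ≡ ι (suc n) * (ι (n C k) * 1/suc k)
ι-absorption n k = begin
  c                              ≡⟨ *-identityʳ c ⟨
  c * 1ℚ                         ≡⟨ cong (c *_) (ι*1/suc k) ⟨
  c * (ι (suc k) * r)            ≡⟨ solve 3 (λ c s r → c :* (s :* r) := (s :* c) :* r) refl c (ι (suc k)) r ⟩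
  (ι (suc k) * c) * r            ≡⟨ cong (_* r) (ι-homo-* (suc k) (suc n C suc k)) ⟨
  ι (suc k ℕ.* (suc n C suc k)) * r
    ≡⟨ cong (λ m → ι m * r) ([1+k]*[1+n]C[1+k]≡[1+n]*nCk n k) ⟩
  ι (suc n ℕ.* (n C k)) * r      ≡⟨ cong (_* r) (ι-homo-* (suc n) (n C k)) ⟩
  ι (suc n) * ι (n C k) * r      ≡⟨ *-assoc (ι (suc n)) (ι (n C k)) r ⟩
  ι (suc n) * (ι (n C k) * r)    ∎
  where
  c = ι (suc n C suc k)
  r = 1/suc k

-- Logarithmic sums and the binomial theorem.

-- Truncation of the series of -log (1 - x).
logSum : ℕ → ℚ → ℚ
logSum n x = ∑[ i < n ] (x ^ suc (toℕ i) * 1/suc (toℕ i))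

-- The same sum with each term multiplied by (-1)ⁱ C(n, i), which is 1 modulo
-- n + 1 if n + 1 is prime. The factor makes the binomial theorem applicable.
binomialSum : ℕ → ℚ → ℚ
binomialSum n x = ∑[ i < n ] (ι (n C toℕ i) * (sgn (toℕ i) * (x ^ suc (toℕ i) * 1/suc (toℕ i))))

-- The terms of index 0 and p = n + 1 are split off, so that absorption extracts a factor p from
-- every term left in the sum.
binomial-expansion : ∀ n x →
  (1ℚ + x) ^ suc n ≡ 1ℚ + (∑[ i < n ] (ι (suc n C suc (toℕ i)) * x ^ suc (toℕ i))) + x ^ suc n
binomial-expansion n x = begin
  (1ℚ + x) ^ p
    -- The summation index is the exponent of the first summand, so `x` has to come first.
    ≡⟨ cong (_^ p) (+-comm 1ℚ x) ⟩
  (x + 1ℚ) ^ p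
    ≡⟨ Binomial.theorem p x 1ℚ ⟩
  sum (Binomial.binomialTerm x 1ℚ p)
    ≡⟨ sum-cong-≗ term-≡ ⟩
  t 0 + sum {suc n} (λ i → t (suc (toℕ i)))
    ≡⟨ cong (λ y → t 0 + y) (sum-init-last {n} (λ i → t (suc (toℕ i)))) ⟩
  t 0 + ((∑[ i < n ] t (suc (toℕ (inject₁ i)))) + t (suc (toℕ (fromℕ n))))
    ≡⟨ cong₂ (λ u v → t 0 + (u + t (suc v)))
         (sum-cong-≗ {n} (λ i → cong (t ∘ suc) (toℕ-inject₁ i))) (toℕ-fromℕ n) ⟩
  t 0 + ((∑[ i < n ] t (suc (toℕ i))) + t p)
    ≡⟨ +-assoc (t 0) (∑[ i < n ] t (suc (toℕ i))) (t p) ⟨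
  t 0 + (∑[ i < n ] t (suc (toℕ i))) + t p
    ≡⟨ cong (λ y → t 0 + (∑[ i < n ] t (suc (toℕ i))) + y) last-term ⟩
  1ℚ + (∑[ i < n ] t (suc (toℕ i))) + x ^ p ∎
  where
  p = suc n
  t : ℕ → ℚ
  t k = ι (p C k) * x ^ k
  last-term : t p ≡ x ^ p
  last-term = trans (cong (λ c → ι c * x ^ p) (nCn≡1 p)) (*-identityˡ (x ^ p))
  term-≡ : ∀ (k : Fin (suc p)) → Binomial.binomialTerm x 1ℚ p k ≡ t (toℕ k)
  term-≡ k = begin
    (p C toℕ k) × (x ^ toℕ k * 1ℚ ^ (p ∸ toℕ k))
      ≡⟨ cong (λ y → (p C toℕ k) × (x ^ toℕ k * y)) (1^n≡1 (p ∸ toℕ k)) ⟩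
    (p C toℕ k) × (x ^ toℕ k * 1ℚ)
      ≡⟨ cong ((p C toℕ k) ×_) (*-identityʳ (x ^ toℕ k)) ⟩
    (p C toℕ k) × x ^ toℕ k
      ≡⟨ ×≡ι* (p C toℕ k) (x ^ toℕ k) ⟩
    t (toℕ k) ∎

-- By absorption, p times each term is -C(p, i + 1) (-x)ⁱ⁺¹; these are, up to sign, the inner terms
-- in the expansion of (1 - x)ᵖ. The identity is exact in ℚ.
binomialSum-scaled : ∀ n x →
  ι (suc n) * binomialSum n x ≡ 1ℚ + (- x) ^ suc n - (1ℚ - x) ^ suc n
binomialSum-scaled n x = begin
  ι p * binomialSum n x
    ≡⟨ *-distribˡ-sum {n} (ι p) _ ⟩
  ∑[ i < n ] (ι p * (ι (n C toℕ i) * (sgn (toℕ i) * (x ^ suc (toℕ i) * 1/suc (toℕ i)))))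
    ≡⟨ sum-cong-≗ {n} (λ i → term-≡ (toℕ i)) ⟩
  ∑[ i < n ] (- 1ℚ * (ι (p C suc (toℕ i)) * (- x) ^ suc (toℕ i)))
    ≡⟨ *-distribˡ-sum {n} (- 1ℚ) _ ⟨
  - 1ℚ * s
    ≡⟨ solve 2 (λ s y → con (- 1ℚ) :* s := con 1ℚ :+ y :- (con 1ℚ :+ s :+ y)) refl s ((- x) ^ p) ⟩
  1ℚ + (- x) ^ p - (1ℚ + s + (- x) ^ p)
    ≡⟨ cong (λ y → 1ℚ + (- x) ^ p - y) (binomial-expansion n (- x)) ⟨
  1ℚ + (- x) ^ p - (1ℚ - x) ^ p ∎
  where
  p = suc n
  s = ∑[ i < n ] (ι (p C suc (toℕ i)) * (- x) ^ suc (toℕ i))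
  term-≡ : ∀ i → ι p * (ι (n C i) * (sgn i * (x ^ suc i * 1/suc i)))
               ≡ - 1ℚ * (ι (p C suc i) * (- x) ^ suc i)
  term-≡ i = begin
    ι p * (ι (n C i) * (sgn i * (x ^ suc i * 1/suc i)))
      ≡⟨ solve 5 (λ q c e y r → q :* (c :* (e :* (y :* r)))
           := con (- 1ℚ) :* (q :* (c :* r) :* (con (- 1ℚ) :* e :* y)))
           refl (ι p) (ι (n C i)) (sgn i) (x ^ suc i) (1/suc i) ⟩
    - 1ℚ * (ι p * (ι (n C i) * 1/suc i) * (sgn (suc i) * x ^ suc i))
      ≡⟨ cong₂ (λ u v → - 1ℚ * (u * v)) (ι-absorption n i) (neg-^ x (suc i)) ⟨
    - 1ℚ * (ι (p C suc i) * (- x) ^ suc i) ∎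

-- The ring of p-integral rationals and its congruences.

-- A common divisor of ab and n is coprime to a, since it divides n, and therefore divides b.
coprime-*ˡ : ∀ {a b n} → Coprime a n → Coprime b n → Coprime (a ℕ.* b) n
coprime-*ˡ a⊥n b⊥n {i} (i∣ab , i∣n) = b⊥n (coprime-divisor i⊥a i∣ab , i∣n)
  where
  i⊥a : Coprime i _
  i⊥a (j∣i , j∣a) = a⊥n (j∣a , ∣-trans j∣i i∣n)

module _ {p : ℕ} where

  -- The reduced denominator divides d, with the gcd of z and d as cofactor. Integrality can thus be
  -- checked on any representation as a fraction.
  /-integral : ∀ z d .{{_ : NonZero d}} → Coprime d p → Integral p (z / d)
  /-integral z d d⊥p (i∣↧ , i∣p) = d⊥p (∣-trans i∣↧ ↧∣d , i∣p)
    where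
    g = ℤ.gcd z (+ d)
    ↧∣d : ↧ₙ (z / d) ∣ d
    ↧∣d = divides ℤ.∣ g ∣ (begin
      d                              ≡⟨ cong ℤ.∣_∣ (↧-/ z d) ⟨
      ℤ.∣ ↧ (z / d) ℤ.* g ∣          ≡⟨ ℤ.abs-* (↧ (z / d)) g ⟩
      ↧ₙ (z / d) ℕ.* ℤ.∣ g ∣         ≡⟨ ℕ.*-comm (↧ₙ (z / d)) ℤ.∣ g ∣ ⟩
      ℤ.∣ g ∣ ℕ.* ↧ₙ (z / d)         ∎)

  ι-integral : ∀ n → Integral p (ι n)
  ι-integral n = /-integral (+ n) 1 (1-coprimeTo p)

  +-integral : ∀ x y → Integral p x → Integral p y → Integral p (x + y)
  -- Exposing `mkℚ` lets the sum compute to one fraction over the product of the denominators.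
  +-integral x@(mkℚ _ _ _) y@(mkℚ _ _ _) x-int y-int =
    /-integral (↥ x ℤ.* ↧ y ℤ.+ ↥ y ℤ.* ↧ x) (↧ₙ x ℕ.* ↧ₙ y) (coprime-*ˡ x-int y-int)

  *-integral : ∀ x y → Integral p x → Integral p y → Integral p (x * y)
  *-integral x@(mkℚ _ _ _) y@(mkℚ _ _ _) x-int y-int =
    /-integral (↥ x ℤ.* ↥ y) (↧ₙ x ℕ.* ↧ₙ y) (coprime-*ˡ x-int y-int)

  neg-integral : ∀ x → Integral p x → Integral p (- x)
  neg-integral (mkℚ (+ zero)   _ _) x-int = x-int
  neg-integral (mkℚ (+ suc _)  _ _) x-int = x-int
  neg-integral (mkℚ ℤ.-[1+ _ ] _ _) x-int = x-int

  ^-integral : ∀ x n → Integral p x → Integral p (x ^ n)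
  ^-integral x zero    x-int = ι-integral 1
  ^-integral x (suc n) x-int = *-integral x (x ^ n) x-int (^-integral x n x-int)

  mod-refl : ∀ x → Integral p x → x ≡ x [mod p ]
  mod-refl x x-int = x-int , x-int , 0ℚ , ι-integral 0 ,
    trans (+-inverseʳ x) (sym (*-zeroʳ (ι p)))

  mod-trans : ∀ x y z → x ≡ y [mod p ] → y ≡ z [mod p ] → x ≡ z [mod p ]
  mod-trans x y z (x-int , _ , u , u-int , eq) (_ , z-int , v , v-int , eq′) =
    x-int , z-int , u + v , +-integral u v u-int v-int , (begin
      x - z             ≡⟨ solve 3 (λ x y z → x :- z := (x :- y) :+ (y :- z)) refl x y z ⟩
      (x - y) + (y - z) ≡⟨ cong₂ _+_ eq eq′ ⟩
      ι p * u + ι p * v ≡⟨ *-distribˡ-+ (ι p) u v ⟨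
      ι p * (u + v)     ∎)

  mod-sym : ∀ x y → x ≡ y [mod p ] → y ≡ x [mod p ]
  mod-sym x y (x-int , y-int , u , u-int , eq) =
    y-int , x-int , - u , neg-integral u u-int , (begin
      y - x       ≡⟨ solve 2 (λ x y → y :- x := :- (x :- y)) refl x y ⟩
      - (x - y)   ≡⟨ cong -_ eq ⟩
      - (ι p * u) ≡⟨ neg-distribʳ-* (ι p) u ⟩
      ι p * - u   ∎)

  mod-+ : ∀ x y z w → x ≡ y [mod p ] → z ≡ w [mod p ] → x + z ≡ y + w [mod p ]
  mod-+ x y z w (x-int , y-int , u , u-int , eq) (z-int , w-int , v , v-int , eq′) =
    +-integral x z x-int z-int , +-integral y w y-int w-int , u + v , +-integral u v u-int v-int , (begin
      (x + z) - (y + w)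
        ≡⟨ solve 4 (λ x y z w → (x :+ z) :- (y :+ w) := (x :- y) :+ (z :- w)) refl x y z w ⟩
      (x - y) + (z - w) ≡⟨ cong₂ _+_ eq eq′ ⟩
      ι p * u + ι p * v ≡⟨ *-distribˡ-+ (ι p) u v ⟨
      ι p * (u + v)     ∎)

  mod-*ʳ : ∀ x y z → Integral p z → x ≡ y [mod p ] → x * z ≡ y * z [mod p ]
  mod-*ʳ x y z z-int (x-int , y-int , u , u-int , eq) =
    *-integral x z x-int z-int , *-integral y z y-int z-int , u * z , *-integral u z u-int z-int , (begin
      x * z - y * z ≡⟨ solve 3 (λ x y z → x :* z :- y :* z := (x :- y) :* z) refl x y z ⟩
      (x - y) * z   ≡⟨ cong (_* z) eq ⟩
      ι p * u * z   ≡⟨ *-assoc (ι p) u z ⟩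
      ι p * (u * z) ∎)

  mod-*ˡ : ∀ x y z → Integral p z → x ≡ y [mod p ] → z * x ≡ z * y [mod p ]
  mod-*ˡ x y z z-int x≡y
    rewrite *-comm z x | *-comm z y = mod-*ʳ x y z z-int x≡y

  mod-neg : ∀ x y → x ≡ y [mod p ] → - x ≡ - y [mod p ]
  mod-neg x y (x-int , y-int , u , u-int , eq) =
    neg-integral x x-int , neg-integral y y-int , - u , neg-integral u u-int , (begin
      - x - - y   ≡⟨ solve 2 (λ x y → :- x :- :- y := :- (x :- y)) refl x y ⟩
      - (x - y)   ≡⟨ cong -_ eq ⟩
      - (ι p * u) ≡⟨ neg-distribʳ-* (ι p) u ⟩
      ι p * - u   ∎)

  mod-sum : ∀ {m} (f g : Fin m → ℚ) → (∀ i → f i ≡ g i [mod p ]) → sum f ≡ sum g [mod p ]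
  mod-sum {zero}  f g f≡g = mod-refl 0ℚ (ι-integral 0)
  mod-sum {suc m} f g f≡g = mod-+ (f zero) (g zero) (sum (f ∘ suc)) (sum (g ∘ suc))
    (f≡g zero) (mod-sum (f ∘ suc) (g ∘ suc) (f≡g ∘ suc))

-- Reduction of logarithmic sums to binomial sums modulo a prime.

1/suc-integral : ∀ {p} → Prime p → ∀ i → suc i < p → Integral p (1/suc i)
1/suc-integral p-prime i i<p =
  /-integral (+ 1) (suc i) (Coprimality.sym (prime⇒coprime p-prime i<p))

-- Induction on i: neighbouring coefficients add up to C(p, i + 1) = p C(n, i) / (i + 1), where p =
-- n + 1. As i + 1 < p is prime to p, this is 0 modulo p, so the sign alternates.
nCi≡sgn : ∀ n → Prime (suc n) → ∀ i → i < suc n → ι (n C i) ≡ sgn i [mod suc n ]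
nCi≡sgn n p-prime zero    _ = mod-refl 1ℚ (ι-integral 1)
nCi≡sgn n p-prime (suc i) i<p with nCi≡sgn n p-prime i (ℕ.<-trans (ℕ.n<1+n i) i<p)
... | c-int , s-int , u , u-int , eq =
  ι-integral (n C suc i) , *-integral (- 1ℚ) (sgn i) (neg-integral 1ℚ (ι-integral 1)) s-int ,
  -- Here p z is the sum of the two neighbours and p u is the error in the induction hypothesis.
  z - u , +-integral z (- u) (*-integral c (1/suc i) c-int (1/suc-integral p-prime i i<p)) (neg-integral u u-int) , (begin
    c′ - sgn (suc i)
      ≡⟨ solve 3 (λ c c′ s → c′ :- con (- 1ℚ) :* s := (c :+ c′) :- (c :- s)) refl c c′ (sgn i) ⟩
    (c + c′) - (c - sgn i)
      ≡⟨ cong₂ _-_ pascal eq ⟩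
    ι (suc n) * z - ι (suc n) * u
      ≡⟨ solve 3 (λ p z u → p :* z :- p :* u := p :* (z :- u)) refl (ι (suc n)) z u ⟩
    ι (suc n) * (z - u) ∎)
  where
  c = ι (n C i)
  c′ = ι (n C suc i)
  z = c * 1/suc i
  pascal : c + c′ ≡ ι (suc n) * z
  pascal = begin
    c + c′                 ≡⟨ ι-homo-+ (n C i) (n C suc i) ⟨
    ι (n C i ℕ.+ n C suc i) ≡⟨ cong ι (nCk+nC[k+1]≡[n+1]C[k+1] n i) ⟩
    ι (suc n C suc i)      ≡⟨ ι-absorption n i ⟩
    ι (suc n) * z          ∎

-- The congruence holds term by term: C(n, i) (-1)ⁱ ≡ (-1)ⁱ (-1)ⁱ = 1, and every denominator i + 1
-- is less than p.
logSum≡binomialSum : ∀ n → Prime (suc n) → ∀ x → Integral (suc n) x →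
                     logSum n x ≡ binomialSum n x [mod suc n ]
logSum≡binomialSum n p-prime x x-int = mod-sum _ _ term-≡
  where
  term-≡ : ∀ (j : Fin n) → let i = toℕ j in
    x ^ suc i * 1/suc i ≡ ι (n C i) * (sgn i * (x ^ suc i * 1/suc i)) [mod suc n ]
  term-≡ j = subst (_≡ ι (n C i) * (sgn i * y) [mod suc n ]) cancel
    (mod-sym (ι (n C i) * (sgn i * y)) (sgn i * (sgn i * y))
      (mod-*ʳ (ι (n C i)) (sgn i) (sgn i * y) (*-integral (sgn i) y s-int y-int) c≡s))
    where
    i = toℕ j
    y = x ^ suc i * 1/suc i
    c≡s = nCi≡sgn n p-prime i (ℕ.m<n⇒m<1+n (toℕ<n j))
    s-int = proj₁ (proj₂ c≡s)
    y-int = *-integral (x ^ suc i) (1/suc i) (^-integral x (suc i) x-int) (1/suc-integral p-prime i (s≤s (toℕ<n j)))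
    cancel : sgn i * (sgn i * y) ≡ y
    cancel = begin
      sgn i * (sgn i * y) ≡⟨ *-assoc (sgn i) (sgn i) y ⟨
      sgn i * sgn i * y   ≡⟨ cong (_* y) (sgn*sgn≡1 i) ⟩
      1ℚ * y              ≡⟨ *-identityˡ y ⟩
      y                   ∎

-- The odd harmonic sum as a combination of logarithmic sums.

-- Half the difference of the values at 1 and -1 keeps the odd powers only. Those sums run up to k =
-- n, one step beyond `H′ n`; the extra term vanishes because n is even.
H′≡logSum : ∀ n → sgn n ≡ 1ℚ → H′ n ≡ ½ * (logSum n 1ℚ - logSum n (- 1ℚ))
H′≡logSum zero    _  = refl
H′≡logSum (suc m) n-even = begin
  ∑[ i < m ] f (toℕ i)
    ≡⟨ +-identityʳ _ ⟨
  (∑[ i < m ] f (toℕ i)) + 0ℚ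
    -- The added zero is read as the term k = m + 1 = n.
    ≡⟨ cong₂ _+_ (sum-cong-≗ {m} (λ i → cong f (toℕ-inject₁ i)))
                 (trans (cong f (toℕ-fromℕ m)) f[m]≡0) ⟨
  (∑[ i < m ] f (toℕ (inject₁ i))) + f (toℕ (fromℕ m))
    ≡⟨ sum-init-last {m} (λ i → f (toℕ i)) ⟨
  ∑[ i < suc m ] f (toℕ i)
    ≡⟨ sum-cong-≗ {suc m} (λ i → split (toℕ i)) ⟩
  ∑[ i < suc m ] (½ * (g 1ℚ i + - 1ℚ * g (- 1ℚ) i))
    ≡⟨ *-distribˡ-sum {suc m} ½ (λ i → g 1ℚ i + - 1ℚ * g (- 1ℚ) i) ⟨
  ½ * ∑[ i < suc m ] (g 1ℚ i + - 1ℚ * g (- 1ℚ) i)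
    ≡⟨ cong (½ *_) (∑-distrib-+ {suc m} (g 1ℚ) (λ i → - 1ℚ * g (- 1ℚ) i)) ⟩
  ½ * (logSum (suc m) 1ℚ + ∑[ i < suc m ] (- 1ℚ * g (- 1ℚ) i))
    ≡⟨ cong (λ y → ½ * (logSum (suc m) 1ℚ + y)) (*-distribˡ-sum {suc m} (- 1ℚ) (g (- 1ℚ))) ⟨
  ½ * (logSum (suc m) 1ℚ + - 1ℚ * logSum (suc m) (- 1ℚ))
    ≡⟨ solve 2 (λ a b → con ½ :* (a :+ con (- 1ℚ) :* b) := con ½ :* (a :- b)) refl
         (logSum (suc m) 1ℚ) (logSum (suc m) (- 1ℚ)) ⟩
  ½ * (logSum (suc m) 1ℚ - logSum (suc m) (- 1ℚ)) ∎
  where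
  f : ℕ → ℚ
  f i = oddReciprocal (suc i)
  g : ℚ → Fin (suc m) → ℚ
  g x i = x ^ suc (toℕ i) * 1/suc (toℕ i)
  f[m]≡0 : f m ≡ 0ℚ
  f[m]≡0 = begin
    f m                                   ≡⟨ oddReciprocal-sgn m ⟩
    ½ * ((1ℚ - sgn (suc m)) * 1/suc m)    ≡⟨ cong (λ s → ½ * ((1ℚ - s) * 1/suc m)) n-even ⟩
    ½ * ((1ℚ - 1ℚ) * 1/suc m)
      ≡⟨ solve 1 (λ r → con ½ :* ((con 1ℚ :- con 1ℚ) :* r) := con 0ℚ) refl (1/suc m) ⟩
    0ℚ ∎
  split : ∀ i → f i ≡ ½ * (1ℚ ^ suc i * 1/suc i + - 1ℚ * (sgn (suc i) * 1/suc i))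
  split i = begin
    f i
      ≡⟨ oddReciprocal-sgn i ⟩
    ½ * ((1ℚ - sgn (suc i)) * 1/suc i)
      ≡⟨ cong (λ y → ½ * ((y - sgn (suc i)) * 1/suc i)) (1^n≡1 (suc i)) ⟨
    ½ * ((1ℚ ^ suc i - sgn (suc i)) * 1/suc i)
      ≡⟨ solve 3 (λ y s r → con ½ :* ((y :- s) :* r) := con ½ :* (y :* r :+ con (- 1ℚ) :* (s :* r)))
           refl (1ℚ ^ suc i) (sgn (suc i)) (1/suc i) ⟩
    ½ * (1ℚ ^ suc i * 1/suc i + - 1ℚ * (sgn (suc i) * 1/suc i)) ∎

-- Comparison of the two Fermat quotients.

ι-cancelˡ : ∀ n {x y} → ι (suc n) * x ≡ ι (suc n) * y → x ≡ y
ι-cancelˡ n {x} {y} eq = trans (sym (unscale x)) (trans (cong (1/suc n *_) eq) (unscale y))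
  where
  unscale : ∀ z → 1/suc n * (ι (suc n) * z) ≡ z
  unscale z = begin
    1/suc n * (ι (suc n) * z) ≡⟨ solve 3 (λ r p z → r :* (p :* z) := p :* r :* z) refl (1/suc n) (ι (suc n)) z ⟩
    ι (suc n) * 1/suc n * z   ≡⟨ cong (_* z) (ι*1/suc n) ⟩
    1ℚ * z                    ≡⟨ *-identityˡ z ⟩
    z                         ∎

-- With p = n + 1, multiplication by p turns T into 1 - 2⁻ⁿ and U into 2ⁿ - 1, so U is the Fermat
-- quotient of 2 when p is prime. The claim becomes an identity in `h` and `P` subject to `h * P` =
-- 1.
fermatQuotients : ∀ n → sgn (suc n) ≡ - 1ℚ →
  let T = binomialSum n ½
      U = ½ * (binomialSum n 1ℚ - binomialSum n (- 1ℚ))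
  in T - U ≡ ι (suc n) * - (T * U)
fermatQuotients n p-odd = ι-cancelˡ n (begin
  p * (T - U)
    ≡⟨ solve 3 (λ p t u → p :* (t :- u) := p :* t :- p :* u) refl p T U ⟩
  p * T - p * U
    ≡⟨ cong₂ _-_ pT pU ⟩
  (1ℚ - h) - (P - 1ℚ)
    ≡⟨ solve 2 (λ h P → (con 1ℚ :- h) :- (P :- con 1ℚ)
         := (con 1ℚ :- h :* P) :- (con 1ℚ :- h) :* (P :- con 1ℚ)) refl h P ⟩
  (1ℚ - h * P) - (1ℚ - h) * (P - 1ℚ)
    ≡⟨ cong (λ y → (1ℚ - y) - (1ℚ - h) * (P - 1ℚ)) (½^n*2^n≡1 n) ⟩
  (1ℚ - 1ℚ) - (1ℚ - h) * (P - 1ℚ)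
    -- Folding the factors back into multiples of p produces the second factor p.
    ≡⟨ cong₂ (λ y z → (1ℚ - 1ℚ) - y * z) pT pU ⟨
  (1ℚ - 1ℚ) - (p * T) * (p * U)
    ≡⟨ solve 3 (λ p t u → (con 1ℚ :- con 1ℚ) :- (p :* t) :* (p :* u)
         := p :* (p :* :- (t :* u))) refl p T U ⟩
  p * (p * - (T * U)) ∎)
  where
  p = ι (suc n)
  T = binomialSum n ½
  A = binomialSum n 1ℚ
  B = binomialSum n (- 1ℚ)
  U = ½ * (A - B)
  h = ½ ^ n
  P = ι 2 ^ n
  pT : p * T ≡ 1ℚ - h
  pT = begin
    p * T
      ≡⟨ binomialSum-scaled n ½ ⟩
    1ℚ + (- ½) ^ suc n - ½ ^ suc n
      ≡⟨ cong (λ y → 1ℚ + y - ½ ^ suc n) (trans (neg-^ ½ (suc n)) (cong (_* ½ ^ suc n) p-odd)) ⟩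
    1ℚ + - 1ℚ * (½ * h) - ½ * h
      ≡⟨ solve 1 (λ h → con 1ℚ :+ con (- 1ℚ) :* (con ½ :* h) :- con ½ :* h := con 1ℚ :- h) refl h ⟩
    1ℚ - h ∎
  -- At x = 1 the closed form is 1 + (-1)ᵖ - 0ᵖ, which vanishes for odd p.
  pA : p * A ≡ 0ℚ
  pA = begin
    p * A                             ≡⟨ binomialSum-scaled n 1ℚ ⟩
    1ℚ + sgn (suc n) - 0ℚ * 0ℚ ^ n    ≡⟨ cong₂ (λ y z → 1ℚ + y - z) p-odd (*-zeroˡ (0ℚ ^ n)) ⟩
    0ℚ                                ∎
  -- At x = -1 the closed form is 1 + 1ᵖ - 2ᵖ.
  pB : p * B ≡ ι 2 - ι 2 * P
  pB = begin
    p * B                             ≡⟨ binomialSum-scaled n (- 1ℚ) ⟩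
    1ℚ + 1ℚ ^ suc n - ι 2 * P         ≡⟨ cong (λ y → 1ℚ + y - ι 2 * P) (1^n≡1 (suc n)) ⟩
    ι 2 - ι 2 * P                     ∎
  pU : p * U ≡ P - 1ℚ
  pU = begin
    p * (½ * (A - B))
      ≡⟨ solve 3 (λ p a b → p :* (con ½ :* (a :- b)) := con ½ :* (p :* a :- p :* b)) refl p A B ⟩
    ½ * (p * A - p * B)
      ≡⟨ cong₂ (λ y z → ½ * (y - z)) pA pB ⟩
    ½ * (0ℚ - (ι 2 - ι 2 * P))
      ≡⟨ solve 1 (λ P → con ½ :* (con 0ℚ :- (con (ι 2) :- con (ι 2) :* P)) := P :- con 1ℚ) refl P ⟩
    P - 1ℚ ∎

theorem2 : (p : ℕ) → Prime p → 3 < p →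
    (∑[ i < p ∸ 1 ] 1/[ suc (toℕ i) *2^ suc (toℕ i) ]) ≡ H′ (p ∸ 1) [mod p ]
theorem2 p@(suc n) p-prime 3<p =
  subst (_≡ H′ n [mod p ]) (sym lhs)
    -- The chain is L(½) ≡ T ≡ U ≡ ½ (L(1) - L(-1)) = `H′ n`.
    (mod-trans (logSum n ½) T (H′ n) (log≡bin ½ ½-int)
      (mod-trans T U (H′ n) T≡U
        (subst (U ≡_[mod p ]) (sym (H′≡logSum n n-even))
          (mod-sym (½ * (L₊ - L₋)) U rhs))))
  where
  T = binomialSum n ½
  L₊ = logSum n 1ℚ
  L₋ = logSum n (- 1ℚ)
  B₊ = binomialSum n 1ℚ
  B₋ = binomialSum n (- 1ℚ)
  U = ½ * (B₊ - B₋)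
  log≡bin : ∀ x → Integral p x → logSum n x ≡ binomialSum n x [mod p ]
  log≡bin = logSum≡binomialSum n p-prime
  2⊥p : Coprime 2 p
  2⊥p = Coprimality.sym (prime⇒coprime p-prime (ℕ.<-trans (ℕ.n<1+n 2) 3<p))
  ½-int : Integral p ½
  ½-int = /-integral (+ 1) 2 2⊥p
  -1-int : Integral p (- 1ℚ)
  -1-int = neg-integral 1ℚ (ι-integral 1)
  p-odd : sgn p ≡ - 1ℚ
  -- If 2 divided p, it would be a common divisor of 2 and p, hence equal to 1.
  p-odd = sgn-odd p (λ 2∣p → case 2⊥p (∣-refl , 2∣p) of λ ())
  n-even : sgn n ≡ 1ℚ
  n-even = begin
    sgn n              ≡⟨ sgn-2+ n ⟨
    - 1ℚ * sgn p       ≡⟨ cong (- 1ℚ *_) p-odd ⟩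
    1ℚ                 ∎
  lhs : (∑[ i < n ] 1/[ suc (toℕ i) *2^ suc (toℕ i) ]) ≡ logSum n ½
  lhs = sum-cong-≗ {n} (λ i → trans (1/[]-split (toℕ i) (suc (toℕ i))) (*-comm _ (½ ^ suc (toℕ i))))
  rhs : ½ * (L₊ - L₋) ≡ U [mod p ]
  rhs = mod-*ˡ (L₊ - L₋) (B₊ - B₋) ½ ½-int
    (mod-+ L₊ B₊ (- L₋) (- B₋) (log≡bin 1ℚ (ι-integral 1))
      (mod-neg L₋ B₋ (log≡bin (- 1ℚ) -1-int)))
  T-int : Integral p T
  -- A congruence carries the integrality of both its sides, so that of `T` is read off.
  T-int = proj₁ (proj₂ (log≡bin ½ ½-int))
  U-int : Integral p U
  U-int = proj₁ (proj₂ rhs)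
  T≡U : T ≡ U [mod p ]
  -- The exact identity T - U = -p T U supplies the witness.
  T≡U = T-int , U-int , - (T * U) , neg-integral (T * U) (*-integral T U T-int U-int) ,
        fermatQuotients n p-odd
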